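{- Let $n\ge 2$, let $\mathbf A=(A,q,\mathsf e_1,\dots,\mathsf e_n)$ be an $n\mathrm{BA}$, and let $(rk)\in S_n$ be a transposition of $\{1,\dots,n\}$. Then the map $x\mapsto x^{(rk)}$ is an isomorphism from the skew reduct $S_r(\mathbf A)=(A,\land_r,\overline\vee_r,\setminus_r,\mathsf e_r)$ onto the skew reduct $S_k(\mathbf A)=(A,\land_k,\overline\vee_k,\setminus_k,\mathsf e_k)$.
   Context: Let $n\ge 2$. An $n\mathrm{BA}$ (Boolean-like algebra of dimension $n$) is an algebra $\mathbf A=(A,q,\mathsf e_1,\dots,\mathsf e_n)$ with $q$ of arity $n+1$ and constants $\mathsf e_1,\dots,\mathsf e_n$ satisfying the identities (B0) $q(\mathsf e_i,x^1,\dots,x^n)=x^i$ for $i=1,\dots,n$; (B1) $q(y,x,\dots,x)=x$; (B2) $q(y,q(y,x^{11},\dots,x^{1n}),\dots,q(y,x^{n1},\dots,x^{nn}))=q(y,x^{11},x^{22},\dots,x^{nn})$; (B3) $q(y,q(x^{10},\dots,x^{1n}),\dots,q(x^{n0},\dots,x^{nn}))=q(q(y,x^{10},\dots,x^{n0}),\dots,q(y,x^{1n},\dots,x^{nn}))$; (B4) $q(y,\mathsf e_1,\dots,\mathsf e_n)=y$. For $i\in\{1,\dots,n\}$ let $t_i(x,y,z)=q(x,w_1,\dots,w_n)$ with $w_i=z$ and $w_k=y$ for $k\ne i$. Define $x\land_i y=t_i(x,y,\mathsf e_i)$, $x\,\overline\vee_i\,y=t_i(x,x,y)$, $y\setminus_i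 x=t_i(x,\mathsf e_i,y)$. For a permutation $\sigma\in S_n$ let $x^\sigma=q(x,\mathsf e_{\sigma 1},\dots,\mathsf e_{\sigma n})$. The transposition $(rk)$, $r\neq k$, exchanges $r$ and $k$. -}

module Defs where

open import Algebra.Core using (Op₂)
import Algebra.Morphism.Definitions as MorphismDefinitions
open import Data.Fin.Base using (Fin)
open import Data.Fin.Permutation using (Permutation′; _⟨$⟩ʳ_)
open import Data.Nat.Base using (ℕ)
open import Data.Vec.Functional using (Vector; replicate; updateAt)
open import Function.Base using (const)
open import Level using (Level; suc; _⊔_)
open import Relation.Binary.Core using (Rel)
open import Relation.Binary.Morphism.Structures using (IsRelIsomorphism)
open import Relation.Binary.Structures using (IsEquivalence)

-- As in Algebra.Bundles, the underlying set is a setoid; `q-cong` says that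
-- q is an operation on it.  The index set {1,…,n} is `Fin n`, and
-- q(y , x¹ , … , xⁿ) is `q y x` with `x : Vector Carrier n`.  In B3 the column
-- x¹⁰ , … , xⁿ⁰ is the separate vector `x₀`.
record BooleanLikeAlgebra (n : ℕ) (a ℓ : Level) : Set (suc (a ⊔ ℓ)) where
  infix 4 _≈_
  field
    Carrier       : Set a
    _≈_           : Rel Carrier ℓ
    isEquivalence : IsEquivalence _≈_
    q             : Carrier → Vector Carrier n → Carrier
    e             : Fin n → Carrier
    q-cong        : ∀ {y z : Carrier} {u v : Vector Carrier n} →
                    y ≈ z → (∀ i → u i ≈ v i) → q y u ≈ q z v
    B0            : ∀ (i : Fin n) (x : Vector Carrier n) → q (e i) x ≈ x i
    B1            : ∀ (y x : Carrier) → q y (replicate n x) ≈ x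
    B2            : ∀ (y : Carrier) (x : Fin n → Vector Carrier n) →
                    q y (λ i → q y (x i)) ≈ q y (λ i → x i i)
    B3            : ∀ (y : Carrier) (x₀ : Vector Carrier n)
                    (x : Fin n → Vector Carrier n) →
                    q y (λ i → q (x₀ i) (x i)) ≈
                    q (q y x₀) (λ j → q y (λ i → x i j))
    B4            : ∀ (y : Carrier) → q y e ≈ y

  t : Fin n → Carrier → Carrier → Carrier → Carrier
  t i x y z = q x (updateAt (replicate n y) i (const z))

  meet : Fin n → Op₂ Carrier
  meet i x y = t i x y (e i)

  join : Fin n → Op₂ Carrier
  join i x y = t i x x y

  -- `diff i y x` is y ∖ᵢ x: the subtracted element x is the first argument
  -- of tᵢ.
  diff : Fin n → Op₂ Carrier
  diff i y x = t i x (e i) y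

  infixl 8 _^_
  _^_ : Carrier → Permutation′ n → Carrier
  x ^ σ = q x (λ i → e (σ ⟨$⟩ʳ i))

-- The similarity type of skew Boolean algebras, without axioms.
record RawSkewBooleanAlgebra (a ℓ : Level) : Set (suc (a ⊔ ℓ)) where
  infix 4 _≈_
  field
    Carrier : Set a
    _≈_     : Rel Carrier ℓ
    _∧_     : Op₂ Carrier
    _∨_     : Op₂ Carrier
    _∖_     : Op₂ Carrier
    0#      : Carrier

skewReduct : ∀ {n : ℕ} {a ℓ : Level} →
             BooleanLikeAlgebra n a ℓ → Fin n → RawSkewBooleanAlgebra a ℓ
skewReduct A i = record
  { Carrier = Carrier
  ; _≈_     = _≈_
  ; _∧_     = meet i
  ; _∨_     = join i
  ; _∖_     = diff i
  ; 0#      = e i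
  }
  where open BooleanLikeAlgebra A

module _ {a b ℓ₁ ℓ₂ : Level}
  (S : RawSkewBooleanAlgebra a ℓ₁) (T : RawSkewBooleanAlgebra b ℓ₂)
  where

  private
    module S = RawSkewBooleanAlgebra S
    module T = RawSkewBooleanAlgebra T
  open MorphismDefinitions S.Carrier T.Carrier T._≈_

  record IsSkewBooleanAlgebraIsomorphism (⟦_⟧ : S.Carrier → T.Carrier)
         : Set (a ⊔ b ⊔ ℓ₁ ⊔ ℓ₂) where
    field
      isRelIsomorphism : IsRelIsomorphism S._≈_ T._≈_ ⟦_⟧
      ∧-homo           : Homomorphic₂ ⟦_⟧ S._∧_ T._∧_
      ∨-homo           : Homomorphic₂ ⟦_⟧ S._∨_ T._∨_
      ∖-homo           : Homomorphic₂ ⟦_⟧ S._∖_ T._∖_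
      0#-homo          : Homomorphic₀ ⟦_⟧ S.0# T.0#

{-# OPTIONS --safe #-}
-- By B3 and B1, q composes associatively in its first argument:
-- q(q(y,w),u) = q(y,q(w₁,u),…,q(wₙ,u)).  Hence t_r(x,y,z)^σ = t_r(x,y^σ,z^σ),
-- while q(x^σ,u) = q(x,u∘σ) gives t_{σr}(x^σ,y^σ,z^σ) = t_r(x,y^σ,z^σ).  So
-- x ↦ x^σ carries t_r to t_{σr}, for every permutation σ, and its inverse is
-- x ↦ x^(σ⁻¹).
module Submission where

open import Defs
open import Data.Fin.Base using (Fin)
open import Data.Fin.Permutation
  using (Permutation′; transpose; flip; inverseˡ; _⟨$⟩ʳ_)
open import Data.Fin.Properties using (_≟_)
open import Data.Nat.Base using (ℕ; _≤_)
open import Data.Product.Base using (_,_)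
open import Data.Vec.Functional using (Vector; replicate; updateAt)
open import Data.Vec.Functional.Properties using (updateAt-updates; updateAt-minimal)
open import Function.Base using (const; _∘_)
import Function.Consequences.Setoid as Consequences
open import Function.Bundles using (Injection)
open import Function.Properties.Inverse using (↔⇒↣)
open import Level using (Level)
open import Relation.Binary.Bundles using (Setoid)
open import Relation.Binary.PropositionalEquality
  using (_≡_; _≢_; refl; cong; subst)
import Relation.Binary.Reasoning.Setoid as SetoidReasoning
open import Relation.Nullary.Decidable using (yes; no; dec-true)

-- `transpose` branches on a decidable test that does not reduce at a variable index, so the test
-- `i ≟ i` has to be rewritten to true.
transpose-left : ∀ {n} (i j : Fin n) → transpose i j ⟨$⟩ʳ i ≡ j
transpose-left i j rewrite dec-true (i ≟ i) refl = refl

module _ {n : ℕ} {a ℓ : Level} (A : BooleanLikeAlgebra n a ℓ) where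
  open BooleanLikeAlgebra A

  setoid : Setoid a ℓ
  setoid = record { isEquivalence = isEquivalence }

  private module S = Setoid setoid
  open SetoidReasoning setoid

  q-assoc : ∀ y (w u : Vector Carrier n) → q (q y w) u ≈ q y (λ i → q (w i) u)
  q-assoc y w u = begin
    -- B1 read backwards gives the outer branches the form of the right side of B3, with every row
    -- equal to `u`.
    q (q y w) u                       ≈⟨ q-cong S.refl (λ j → B1 y (u j)) ⟨
    q (q y w) (λ j → q y (λ _ → u j)) ≈⟨ B3 y w (λ _ → u) ⟨
    q y (λ i → q (w i) u)             ∎

  q-^ : ∀ x σ (u : Vector Carrier n) → q (x ^ σ) u ≈ q x (λ i → u (σ ⟨$⟩ʳ i))
  q-^ x σ u = S.trans (q-assoc x _ u) (q-cong S.refl (λ i → B0 (σ ⟨$⟩ʳ i) u))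

  ^-cong : ∀ σ {x y} → x ≈ y → x ^ σ ≈ y ^ σ
  ^-cong σ x≈y = q-cong x≈y (λ _ → S.refl)

  ^-flipʳ : ∀ σ x → x ^ σ ^ flip σ ≈ x
  ^-flipʳ σ x = begin
    x ^ σ ^ flip σ                         ≈⟨ q-^ x σ _ ⟩
    q x (λ i → e (flip σ ⟨$⟩ʳ (σ ⟨$⟩ʳ i))) ≈⟨ q-cong S.refl (λ i → S.reflexive (cong e (inverseˡ σ))) ⟩
    q x e                                  ≈⟨ B4 x ⟩
    x                                      ∎

  ^-flipˡ : ∀ σ x → x ^ flip σ ^ σ ≈ x
  -- `_^_` sees only the forward map, and that of `flip (flip σ)` is definitionally that of `σ`.
  ^-flipˡ σ = ^-flipʳ (flip σ)

  -- Leaving `y′` and `z′` free up to `≈` lets a branch `e r` be sent directly to `e (σ ⟨$⟩ʳ r)`.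
  t-^ : ∀ σ r x {y y′ z z′} → y ^ σ ≈ y′ → z ^ σ ≈ z′ →
        t r x y z ^ σ ≈ t (σ ⟨$⟩ʳ r) (x ^ σ) y′ z′
  t-^ σ r x {y} {y′} {z} {z′} y^σ≈y′ z^σ≈z′ = begin
    t r x y z ^ σ                ≈⟨ q-assoc x w _ ⟩
    q x (λ i → w i ^ σ)          ≈⟨ q-cong S.refl w^σ≈w′∘σ ⟩
    q x (λ i → w′ (σ ⟨$⟩ʳ i))    ≈⟨ q-^ x σ w′ ⟨
    t (σ ⟨$⟩ʳ r) (x ^ σ) y′ z′   ∎
    where
    w w′ : Vector Carrier n
    w  = updateAt (replicate n y) r (const z)
    w′ = updateAt (replicate n y′) (σ ⟨$⟩ʳ r) (const z′)

    w^σ≈w′∘σ : ∀ i → w i ^ σ ≈ w′ (σ ⟨$⟩ʳ i)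
    w^σ≈w′∘σ i with i ≟ r
    ... | yes refl
      rewrite updateAt-updates r {const z} (replicate n y)
            | updateAt-updates (σ ⟨$⟩ʳ r) {const z′} (replicate n y′) = z^σ≈z′
    -- Injectivity of `σ` keeps the image of `i` away from the updated slot `σ ⟨$⟩ʳ r`.
    ... | no i≢r
      rewrite updateAt-minimal i r {const z} (replicate n y) i≢r
            | updateAt-minimal (σ ⟨$⟩ʳ i) (σ ⟨$⟩ʳ r) {const z′} (replicate n y′)
                (i≢r ∘ Injection.injective (↔⇒↣ σ)) = y^σ≈y′

  ^-isIsomorphism : ∀ σ r →
    IsSkewBooleanAlgebraIsomorphism (skewReduct A r) (skewReduct A (σ ⟨$⟩ʳ r)) (_^ σ)
  ^-isIsomorphism σ r = record
    { isRelIsomorphism = record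
      { isMonomorphism = record
        { isHomomorphism = record { cong = ^-cong σ }
        ; injective      = λ {x} {y} x^σ≈y^σ → begin
            x              ≈⟨ ^-flipʳ σ x ⟨
            x ^ σ ^ flip σ ≈⟨ ^-cong (flip σ) x^σ≈y^σ ⟩
            y ^ σ ^ flip σ ≈⟨ ^-flipʳ σ y ⟩
            y              ∎
        }
      ; surjective = Consequences.strictlySurjective⇒surjective setoid setoid
          (^-cong σ) (λ x → x ^ flip σ , ^-flipˡ σ x)
      }
    -- Each operation is a `t r` term; `e-^` serves the branch holding the constant, reflexivity the
    -- branches holding variables.
    ; ∧-homo  = λ x y → t-^ σ r x S.refl e-^
    ; ∨-homo  = λ x y → t-^ σ r x S.refl S.refl
    ; ∖-homo  = λ y x → t-^ σ r x e-^ S.refl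
    ; 0#-homo = e-^
    }
    where
    e-^ : e r ^ σ ≈ e (σ ⟨$⟩ʳ r)
    e-^ = B0 r _

theorem4p9 : ∀ {a ℓ : Level} (n : ℕ) → 2 ≤ n →
    (A : BooleanLikeAlgebra n a ℓ) (r k : Fin n) → r ≢ k →
    IsSkewBooleanAlgebraIsomorphism (skewReduct A r) (skewReduct A k)
    (λ x → BooleanLikeAlgebra._^_ A x (transpose r k))
theorem4p9 n _ A r k _ =
  -- The general result lands in the reduct at the image of `r`, which equals `k` only
  -- propositionally.
  subst (λ j → IsSkewBooleanAlgebraIsomorphism (skewReduct A r) (skewReduct A j)
                 (λ x → BooleanLikeAlgebra._^_ A x (transpose r k)))
        (transpose-left r k) (^-isIsomorphism A (transpose r k) r)
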